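{- For every nonnegative integer $n$, $$\sum_{k=0}^{\infty}(-1)^k(4k+1)\,\frac{(-3n)_k\,(-4n-\tfrac16)_k\,(\tfrac12)_k}{k!\,(3n+\tfrac32)_k\,(4n+\tfrac53)_k}=\left(\frac{2^8 3^3}{7^7}\right)^n\frac{(\tfrac{11}{12})_n(\tfrac56)_n(\tfrac12)_n(\tfrac{5}{12})_n(\tfrac76)_n^2}{(\tfrac{11}{21})_n(\tfrac{23}{21})_n(\tfrac{5}{21})_n(\tfrac{17}{21})_n(\tfrac{8}{21})_n(\tfrac{20}{21})_n}.$$ (The sum is finite, since $(-3n)_k=0$ for $k>3n$.)
   Context: $(a)_j=\Gamma(a+j)/\Gamma(a)=a(a+1)\cdots(a+j-1)$ denotes the rising factorial (Pochhammer symbol), with $(a)_0=1$. -}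

module Defs where

open import Data.Nat.Base as ℕ using (ℕ; zero; suc; _!)
open import Data.Nat.Properties using (_!≢0)
open import Data.Integer.Base using (+_)
open import Data.Product.Base using (∃-syntax; _×_)
open import Data.Rational.Base
open import Data.Rational.Properties
open import Relation.Binary.PropositionalEquality.Core using (_≡_)

open import Algebra.Definitions.RawSemiring +-*-rawSemiring using (_^_)

ι : ℕ → ℚ
ι n = + n / 1

rising : ℚ → ℕ → ℚ
rising a zero    = 1ℚ
rising a (suc j) = rising a j * (a + ι j)

partialSum : (ℕ → ℚ) → ℕ → ℚ
partialSum f zero    = 0ℚ
partialSum f (suc m) = partialSum f m + f m

-- The value of an infinite series with only finitely many nonzero terms:
-- f vanishes from some index N on, and f 0 + ⋯ + f (N - 1) = s.
HasFiniteSum : (ℕ → ℚ) → ℚ → Set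
HasFiniteSum f s =
  ∃[ N ] (∀ k → N ℕ.≤ k → f k ≡ 0ℚ) × partialSum f N ≡ s

0≤ι : ∀ n → 0ℚ ≤ ι n
0≤ι n = nonNegative⁻¹ (ι n) {{normalize-nonNeg n 1}}

0<* : ∀ {p q} → 0ℚ < p → 0ℚ < q → 0ℚ < p * q
0<* {p} {q} p>0 q>0 =
  positive⁻¹ (p * q) {{pos*pos⇒pos p {{positive p>0}} q {{positive q>0}}}}

0<rising : ∀ {a} → 0ℚ < a → ∀ k → 0ℚ < rising a k
0<rising a>0 zero    = positive⁻¹ 1ℚ
0<rising a>0 (suc k) = 0<* (0<rising a>0 k) (+-mono-<-≤ a>0 (0≤ι k))

summandDenominator : ℕ → ℕ → ℚ
summandDenominator n k =
    ι (k !)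
  * rising (ι (3 ℕ.* n) + + 3 / 2) k
  * rising (ι (4 ℕ.* n) + + 5 / 3) k

summandDenominator-nonZero : ∀ n k → NonZero (summandDenominator n k)
summandDenominator-nonZero n k = >-nonZero
  (0<* (0<* (positive⁻¹ (ι (k !)) {{normalize-pos (k !) 1 {{_}} {{k !≢0}}}})
            (0<rising (+-mono-≤-< (0≤ι (3 ℕ.* n)) (positive⁻¹ (+ 3 / 2))) k))
       (0<rising (+-mono-≤-< (0≤ι (4 ℕ.* n)) (positive⁻¹ (+ 5 / 3))) k))

summand : ℕ → ℕ → ℚ
summand n k =
  (- 1ℚ) ^ k * ι (4 ℕ.* k ℕ.+ 1) *
  ((  rising (- ι (3 ℕ.* n)) k
    * rising (- ι (4 ℕ.* n) - + 1 / 6) k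
    * rising (+ 1 / 2) k)
   ÷ summandDenominator n k) {{summandDenominator-nonZero n k}}

productDenominator : ℕ → ℚ
productDenominator n =
    rising (+ 11 / 21) n
  * rising (+ 23 / 21) n
  * rising (+  5 / 21) n
  * rising (+ 17 / 21) n
  * rising (+  8 / 21) n
  * rising (+ 20 / 21) n

productDenominator-nonZero : ∀ n → NonZero (productDenominator n)
productDenominator-nonZero n = >-nonZero
  (0<* (0<* (0<* (0<* (0<*
    (0<rising (positive⁻¹ (+ 11 / 21)) n)
    (0<rising (positive⁻¹ (+ 23 / 21)) n))
    (0<rising (positive⁻¹ (+  5 / 21)) n))
    (0<rising (positive⁻¹ (+ 17 / 21)) n))
    (0<rising (positive⁻¹ (+  8 / 21)) n))
    (0<rising (positive⁻¹ (+ 20 / 21)) n))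

closedForm : ℕ → ℚ
closedForm n =
  (+ (2 ℕ.^ 8 ℕ.* 3 ℕ.^ 3) / 7 ℕ.^ 7) ^ n *
  ((  rising (+ 11 / 12) n
    * rising (+  5 /  6) n
    * rising (+  1 /  2) n
    * rising (+  5 / 12) n
    * rising (+  7 /  6) n ^ 2)
   ÷ productDenominator n) {{productDenominator-nonZero n}}

{-# OPTIONS --safe #-}

-- With a = 1/2, N = 3n and d = 4n + 5/3 the series is the terminating
-- very-well-poised sum
--   Σₖ (-1)ᵏ (a+2k) (a)ₖ(-N)ₖ(1+a-d)ₖ / (k! (N+1+a)ₖ (d)ₖ) = a (1+a)_N / (d)_N,
-- which is proved for fixed d by induction on N: (d+N) S_{N+1} = (N+1+a) S_N because the
-- difference of the summands telescopes (a Wilf-Zeilberger pair).  The resulting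
-- (3/2)_{3n} / (4n+5/3)_{3n} is (3/2)_{3n} (5/3)_{4n} / (5/3)_{7n}, and Gauss'
-- multiplication formula splits the three factors into the closed form; the two
-- factors (2/3)ₙ from (5/3)_{4n} and (5/3)_{7n} cancel.
module Submission where

open import Defs
open import Data.Nat.Base as ℕ using (ℕ; zero; suc; _!)
import Data.Nat.Properties as ℕ
open import Data.Integer.Base using (+_)
import Data.Integer.Base as ℤ
import Data.Integer.Properties as ℤ
open import Data.Product.Base using (_×_; _,_)
open import Data.Rational.Base
open import Data.Rational.Properties
open import Data.Rational.Solver using (module +-*-Solver)
import Data.Rational.Unnormalised.Base as ℚᵘ
import Data.Rational.Unnormalised.Properties as ℚᵘ
open import Data.Sum.Base using (inj₁; inj₂)
open import Relation.Binary.PropositionalEquality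
  using (_≡_; refl; sym; trans; cong; cong₂; module ≡-Reasoning)

open import Algebra.Bundles using (CommutativeRing)
open import Algebra.Definitions.RawSemiring +-*-rawSemiring using (_^_)
open import Algebra.Properties.CommutativeSemiring.Exp
  (CommutativeRing.commutativeSemiring +-*-commutativeRing) using (^-distrib-*)
open +-*-Solver
open ≡-Reasoning

-- Embedding of the natural numbers into the rationals.

-- Normalisation in `_/_` divides by a gcd that is stuck on variables, so the identity is checked on
-- unnormalised fractions and pulled back along the injective `toℚᵘ`.
ι-homo-+ : ∀ m n → ι (m ℕ.+ n) ≡ ι m + ι n
ι-homo-+ m n = toℚᵘ-injective
  (ℚᵘ.≃-trans (toℚᵘ-fromℚᵘ (ℚᵘ.mkℚᵘ (+ (m ℕ.+ n)) 0))
  (ℚᵘ.≃-trans (ℚᵘ.*≡* (cong (λ z → z ℤ.* (+ 1))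
    (sym (cong₂ ℤ._+_ (ℤ.*-identityʳ (+ m)) (ℤ.*-identityʳ (+ n))))))
  (ℚᵘ.≃-trans (ℚᵘ.+-cong (ℚᵘ.≃-sym (toℚᵘ-fromℚᵘ (ℚᵘ.mkℚᵘ (+ m) 0)))
                          (ℚᵘ.≃-sym (toℚᵘ-fromℚᵘ (ℚᵘ.mkℚᵘ (+ n) 0))))
  (ℚᵘ.≃-sym (toℚᵘ-homo-+ (ι m) (ι n))))))

ι-suc : ∀ n → ι (suc n) ≡ 1ℚ + ι n
ι-suc = ι-homo-+ 1

ι-homo-* : ∀ m n → ι (m ℕ.* n) ≡ ι m * ι n
ι-homo-* zero    n = sym (*-zeroˡ (ι n))
ι-homo-* (suc m) n = begin
  ι (n ℕ.+ m ℕ.* n)    ≡⟨ ι-homo-+ n (m ℕ.* n) ⟩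
  ι n + ι (m ℕ.* n)    ≡⟨ cong (_+_ (ι n)) (ι-homo-* m n) ⟩
  ι n + ι m * ι n      ≡⟨ solve 2 (λ x y → y :+ x :* y := (con 1ℚ :+ x) :* y) refl (ι m) (ι n) ⟩
  (1ℚ + ι m) * ι n     ≡⟨ cong (_* ι n) (ι-suc m) ⟨
  ι (suc m) * ι n      ∎

ι-homo-^ : ∀ m n → ι (m ℕ.^ n) ≡ ι m ^ n
ι-homo-^ m zero    = refl
ι-homo-^ m (suc n) = trans (ι-homo-* m (m ℕ.^ n)) (cong (_*_ (ι m)) (ι-homo-^ m n))

/-*-cancel : ∀ m n .{{_ : ℕ.NonZero n}} → (+ m / n) * ι n ≡ ι m
/-*-cancel m n@(suc n-1) = toℚᵘ-injective
  (ℚᵘ.≃-trans (toℚᵘ-homo-* (+ m / n) (ι n))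
  (ℚᵘ.≃-trans (ℚᵘ.*-cong (toℚᵘ-fromℚᵘ (ℚᵘ.mkℚᵘ (+ m) n-1)) (toℚᵘ-fromℚᵘ (ℚᵘ.mkℚᵘ (+ n) 0)))
  (ℚᵘ.≃-trans (ℚᵘ.*≡* {ℚᵘ.mkℚᵘ (+ m) n-1 ℚᵘ.* ℚᵘ.mkℚᵘ (+ n) 0} {ℚᵘ.mkℚᵘ (+ m) 0}
                (trans (ℤ.*-assoc (+ m) (+ n) (+ 1)) (cong (ℤ._*_ (+ m)) (sym (ℤ.pos-* n 1)))))
  (ℚᵘ.≃-sym (toℚᵘ-fromℚᵘ (ℚᵘ.mkℚᵘ (+ m) 0))))))

-- Cancellation and clearing of denominators.

*-cancelʳ-≡ : ∀ r .{{_ : NonZero r}} {p q} → p * r ≡ q * r → p ≡ q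
*-cancelʳ-≡ r {p} {q} pr≡qr = begin
  p              ≡⟨ unit p ⟩
  p * r * 1/ r   ≡⟨ cong (_* 1/ r) pr≡qr ⟩
  q * r * 1/ r   ≡⟨ unit q ⟨
  q              ∎
  where
  unit : ∀ x → x ≡ x * r * 1/ r
  unit x = begin
    x                ≡⟨ *-identityʳ x ⟨
    x * 1ℚ           ≡⟨ cong (x *_) (*-inverseʳ r) ⟨
    x * (r * 1/ r)   ≡⟨ *-assoc x r (1/ r) ⟨
    x * r * 1/ r     ∎

÷-*-cancel : ∀ p q .{{_ : NonZero q}} → (p ÷ q) * q ≡ p
÷-*-cancel p q =
  trans (*-assoc p (1/ q) q) (trans (cong (p *_) (*-inverseˡ q)) (*-identityʳ p))

-- Reduces the shift relations between hypergeometric terms to division-free identities.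
*-÷-cross : ∀ u v p q r s .{{_ : NonZero q}} .{{_ : NonZero s}} →
            u * p * s ≡ v * r * q → u * (p ÷ q) ≡ v * (r ÷ s)
*-÷-cross u v p q r s eq = *-cancelʳ-≡ q (*-cancelʳ-≡ s (begin
  u * (p ÷ q) * q * s     ≡⟨ cong (_* s) (trans (*-assoc u _ q) (cong (u *_) (÷-*-cancel p q))) ⟩
  u * p * s               ≡⟨ eq ⟩
  v * r * q               ≡⟨ cong (λ x → v * x * q) (÷-*-cancel r s) ⟨
  v * ((r ÷ s) * s) * q   ≡⟨ solve 4 (λ v x s q → v :* (x :* s) :* q := v :* x :* q :* s) refl v (r ÷ s) s q ⟩
  v * (r ÷ s) * q * s     ∎))

-- Factorials and rising factorials.

ι!-positive : ∀ k → 0ℚ < ι (k !)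
ι!-positive k = positive⁻¹ (ι (k !)) {{normalize-pos (k !) 1 {{_}} {{k ℕ.!≢0}}}}

-- The definition of `rising` splits off the last factor; comparing parameters that differ by one
-- needs the first.
rising-suc : ∀ x k → rising x (suc k) ≡ x * rising (1ℚ + x) k
rising-suc x zero = solve 1 (λ x → con 1ℚ :* (x :+ con 0ℚ) := x :* con 1ℚ) refl x
rising-suc x (suc k) = begin
  rising x (suc k) * (x + ι (suc k))              ≡⟨ cong₂ _*_ (rising-suc x k) (cong (_+_ x) (ι-suc k)) ⟩
  x * rising (1ℚ + x) k * (x + (1ℚ + ι k))        ≡⟨ solve 3 (λ x r k → x :* r :* (x :+ (con 1ℚ :+ k)) := x :* (r :* (con 1ℚ :+ x :+ k))) refl x (rising (1ℚ + x) k) (ι k) ⟩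
  x * (rising (1ℚ + x) k * (1ℚ + x + ι k))        ∎

rising-+ : ∀ x m n → rising x (m ℕ.+ n) ≡ rising x m * rising (ι m + x) n
rising-+ x m zero rewrite ℕ.+-identityʳ m = sym (*-identityʳ _)
rising-+ x m (suc n) rewrite ℕ.+-suc m n = begin
  rising x (m ℕ.+ n) * (x + ι (m ℕ.+ n))                 ≡⟨ cong₂ _*_ (rising-+ x m n) (cong (_+_ x) (ι-homo-+ m n)) ⟩
  rising x m * rising (ι m + x) n * (x + (ι m + ι n))    ≡⟨ solve 5 (λ x m n r s → r :* s :* (x :+ (m :+ n)) := r :* (s :* (m :+ x :+ n))) refl x (ι m) (ι n) (rising x m) (rising (ι m + x) n) ⟩
  rising x m * (rising (ι m + x) n * (ι m + x + ι n))    ∎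

-- The factor with index `N` is `- ι N + ι N`, and every longer product contains it.
rising-neg-vanishes : ∀ {N k} → N ℕ.< k → rising (- ι N) k ≡ 0ℚ
rising-neg-vanishes {N} {suc k} (ℕ.s≤s N≤k) with ℕ.m≤n⇒m<n∨m≡n N≤k
... | inj₁ N<k = trans (cong (_* (- ι N + ι k)) (rising-neg-vanishes N<k)) (*-zeroˡ (- ι N + ι k))
... | inj₂ refl = trans (cong (rising (- ι N) N *_) (+-inverseˡ (ι N))) (*-zeroʳ (rising (- ι N) N))

0<^ : ∀ {p} → 0ℚ < p → ∀ n → 0ℚ < p ^ n
0<^ 0<p zero    = positive⁻¹ 1ℚ
0<^ 0<p (suc n) = 0<* 0<p (0<^ 0<p n)

-- Gauss' multiplication formula.

-- For `j = m` and `h = 1/m` this is the product of shifted rising factorials in Gauss' formula.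
risingProgression : ℚ → ℚ → ℕ → ℕ → ℚ
risingProgression b h zero    n = 1ℚ
risingProgression b h (suc j) n = risingProgression b h j n * rising (b + h * ι j) n

-- Passing from `n` to `n + 1` adds `m` consecutive factors on the left. The `j`-th of them is `ι m`
-- times the new last factor of the `j`-th rising factorial on the right.
rising-multiplication : ∀ m {h} → ι m * h ≡ 1ℚ → ∀ b n →
  rising (ι m * b) (n ℕ.* m) ≡ (ι m ^ m) ^ n * risingProgression b h m n
rising-multiplication m {h} mh≡1 b zero = sym (trans (*-identityˡ _) (empty m))
  where
  empty : ∀ j → risingProgression b h j 0 ≡ 1ℚ
  empty zero    = refl
  empty (suc j) = trans (*-identityʳ _) (empty j)
rising-multiplication m {h} mh≡1 b (suc n) = begin
  rising (ι m * b) (m ℕ.+ n ℕ.* m)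
    ≡⟨ cong (rising (ι m * b)) (ℕ.+-comm m (n ℕ.* m)) ⟩
  rising (ι m * b) (n ℕ.* m ℕ.+ m)
    ≡⟨ rising-+ (ι m * b) (n ℕ.* m) m ⟩
  rising (ι m * b) (n ℕ.* m) * block m
    ≡⟨ cong (_* block m) (rising-multiplication m mh≡1 b n) ⟩
  (ι m ^ m) ^ n * P m n * block m
    ≡⟨ *-assoc ((ι m ^ m) ^ n) (P m n) (block m) ⟩
  (ι m ^ m) ^ n * (P m n * block m)
    ≡⟨ cong (_*_ ((ι m ^ m) ^ n)) (extend m) ⟩
  (ι m ^ m) ^ n * (ι m ^ m * P m (suc n))
    ≡⟨ solve 3 (λ x y z → x :* (y :* z) := y :* x :* z) refl ((ι m ^ m) ^ n) (ι m ^ m) (P m (suc n)) ⟩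
  (ι m ^ m) ^ suc n * P m (suc n) ∎
  where
  P = risingProgression b h
  block = rising (ι (n ℕ.* m) + ι m * b)
  factor : ∀ j → ι (n ℕ.* m) + ι m * b + ι j ≡ ι m * (b + h * ι j + ι n)
  factor j = begin
    ι (n ℕ.* m) + ι m * b + ι j
      ≡⟨ cong₂ (λ u v → u + ι m * b + v) (ι-homo-* n m) (sym (*-identityˡ (ι j))) ⟩
    ι n * ι m + ι m * b + 1ℚ * ι j
      ≡⟨ cong (λ u → ι n * ι m + ι m * b + u * ι j) mh≡1 ⟨
    ι n * ι m + ι m * b + ι m * h * ι j
      ≡⟨ solve 5 (λ n m b h j → n :* m :+ m :* b :+ m :* h :* j := m :* (b :+ h :* j :+ n)) refl (ι n) (ι m) b h (ι j) ⟩
    ι m * (b + h * ι j + ι n) ∎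
  -- Only the first `j` residues are extended; `j = m` completes the induction step.
  extend : ∀ j → P j n * block j ≡ ι m ^ j * P j (suc n)
  extend zero    = refl
  extend (suc j) = begin
    P j n * r * (block j * (ι (n ℕ.* m) + ι m * b + ι j))
      ≡⟨ cong (λ f → P j n * r * (block j * f)) (factor j) ⟩
    P j n * r * (block j * (ι m * f))
      ≡⟨ solve 5 (λ p r b m f → p :* r :* (b :* (m :* f)) := p :* b :* (m :* (r :* f))) refl (P j n) r (block j) (ι m) f ⟩
    P j n * block j * (ι m * (r * f))
      ≡⟨ cong (_* (ι m * (r * f))) (extend j) ⟩
    ι m ^ j * P j (suc n) * (ι m * (r * f))
      ≡⟨ solve 4 (λ e p m r → e :* p :* (m :* r) := m :* e :* (p :* r)) refl (ι m ^ j) (P j (suc n)) (ι m) (r * f) ⟩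
    ι m ^ suc j * P (suc j) (suc n) ∎
    where
    r = rising (b + h * ι j) n
    f = b + h * ι j + ι n

-- The terminating very-well-poised sum.

module VeryWellPoised (a d : ℚ) (0<1+a : 0ℚ < 1ℚ + a) (0<d : 0ℚ < d) where

  -- Well-poised pairing: `c + d = 1 + a`, just as `- ι N` and `ι N + (1ℚ + a)` add up to `1 + a`.
  c : ℚ
  c = 1ℚ + a - d

  numerator denominator : ℕ → ℕ → ℚ
  numerator   N k = rising (- ι N) k * rising c k * rising a k
  denominator N k = ι (k !) * rising (ι N + (1ℚ + a)) k * rising d k

  denominator-nonZero : ∀ N k → NonZero (denominator N k)
  denominator-nonZero N k = >-nonZero
    (0<* (0<* (ι!-positive k) (0<rising (+-mono-≤-< (0≤ι N) 0<1+a) k)) (0<rising 0<d k))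

  -- `ratio` omits the very-well-poised factor `a + 2k`, so that its shifts in `k` and in `N`
  -- multiply it by quotients of linear factors.
  ratio term : ℕ → ℕ → ℚ
  ratio N k = (- 1ℚ) ^ k * (numerator N k ÷ denominator N k) {{denominator-nonZero N k}}
  term  N k = (a + (ι k + ι k)) * ratio N k

  ratio-suc-k : ∀ N k →
    ratio N (suc k) * ((1ℚ + ι k) * (ι N + (1ℚ + a) + ι k) * (d + ι k))
    ≡ - (ratio N k * ((- ι N + ι k) * (c + ι k) * (a + ι k)))
  ratio-suc-k N k = begin
    ratio N (suc k) * z
      ≡⟨ solve 3 (λ s q z → (:- con 1ℚ :* s) :* q :* z := (:- (s :* z)) :* q) refl s (numerator N (suc k) ÷ denominator N (suc k)) z ⟩
    - (s * z) * (numerator N (suc k) ÷ denominator N (suc k))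
      ≡⟨ *-÷-cross (- (s * z)) (- (s * y)) (numerator N (suc k)) (denominator N (suc k)) (numerator N k) (denominator N k) cross ⟩
    - (s * y) * (numerator N k ÷ denominator N k)
      ≡⟨ solve 3 (λ s q y → (:- (s :* y)) :* q := :- (s :* q :* y)) refl s (numerator N k ÷ denominator N k) y ⟩
    - (ratio N k * y) ∎
    where
    instance
      _ = denominator-nonZero N k
      _ = denominator-nonZero N (suc k)
    s = (- 1ℚ) ^ k
    z = (1ℚ + ι k) * (ι N + (1ℚ + a) + ι k) * (d + ι k)
    y = (- ι N + ι k) * (c + ι k) * (a + ι k)
    ι-suc! : ι (suc k !) ≡ (1ℚ + ι k) * ι (k !)
    ι-suc! = trans (ι-homo-* (suc k) (k !)) (cong (_* ι (k !)) (ι-suc k))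
    cross : - (s * z) * numerator N (suc k) * denominator N k
          ≡ - (s * y) * numerator N k * denominator N (suc k)
    -- The rising factorials at `suc k` unfold to their factors by definition; the factorial under
    -- `ι` does not, and is restored by the final `cong`.
    cross = trans
      (solve 13 (λ s z₁ z₂ z₃ y₁ y₂ y₃ p q r f g h →
         :- (s :* (z₁ :* z₂ :* z₃)) :* ((p :* y₁) :* (q :* y₂) :* (r :* y₃)) :* (f :* g :* h)
         := :- (s :* (y₁ :* y₂ :* y₃)) :* (p :* q :* r) :* ((z₁ :* f) :* (g :* z₂) :* (h :* z₃)))
       refl s (1ℚ + ι k) (ι N + (1ℚ + a) + ι k) (d + ι k)
       (- ι N + ι k) (c + ι k) (a + ι k)
       (rising (- ι N) k) (rising c k) (rising a k)
       (ι (k !)) (rising (ι N + (1ℚ + a)) k) (rising d k))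
      (cong (λ f → - (s * y) * numerator N k
                   * (f * rising (ι N + (1ℚ + a)) (suc k) * rising d (suc k)))
            (sym ι-suc!))

  -- Only the two rising factorials containing `N` change. The division-free form also covers
  -- `k = N + 1`, where `1ℚ + ι N - ι k` is zero.
  ratio-suc-N : ∀ N k →
    ratio N k * ((1ℚ + ι N) * (ι N + (1ℚ + a)))
    ≡ ratio (suc N) k * ((1ℚ + ι N - ι k) * (ι N + (1ℚ + a) + ι k))
  ratio-suc-N N k = begin
    ratio N k * z
      ≡⟨ solve 3 (λ s q z → s :* q :* z := (s :* z) :* q) refl s (numerator N k ÷ denominator N k) z ⟩
    s * z * (numerator N k ÷ denominator N k)
      ≡⟨ *-÷-cross (s * z) (s * y) (numerator N k) (denominator N k) (numerator (suc N) k) (denominator (suc N) k) cross ⟩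
    s * y * (numerator (suc N) k ÷ denominator (suc N) k)
      ≡⟨ solve 3 (λ s q y → (s :* y) :* q := s :* q :* y) refl s (numerator (suc N) k ÷ denominator (suc N) k) y ⟩
    ratio (suc N) k * y ∎
    where
    instance
      _ = denominator-nonZero N k
      _ = denominator-nonZero (suc N) k
    s = (- 1ℚ) ^ k
    x = ι N + (1ℚ + a)
    z = (1ℚ + ι N) * x
    y = (1ℚ + ι N - ι k) * (x + ι k)
    A  = rising (- ι N) k
    A′ = rising (- ι (suc N)) k
    B  = rising x k
    B′ = rising (ι (suc N) + (1ℚ + a)) k
    -- Up to sign both sides are `rising (- ι (suc N)) (suc k)`, split at its last and at its first
    -- factor.
    shiftA : A′ * (1ℚ + ι N - ι k) ≡ (1ℚ + ι N) * A
    shiftA = begin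
      A′ * (1ℚ + ι N - ι k)
        ≡⟨ solve 3 (λ r n k → r :* (con 1ℚ :+ n :- k) := :- (r :* (:- (con 1ℚ :+ n) :+ k))) refl A′ (ι N) (ι k) ⟩
      - (A′ * (- (1ℚ + ι N) + ι k))
        ≡⟨ cong (λ i → - (A′ * (- i + ι k))) (ι-suc N) ⟨
      - rising (- ι (suc N)) (suc k)
        ≡⟨ cong -_ (rising-suc (- ι (suc N)) k) ⟩
      - (- ι (suc N) * rising (1ℚ - ι (suc N)) k)
        ≡⟨ cong (λ i → - (- i * rising (1ℚ - i) k)) (ι-suc N) ⟩
      - (- (1ℚ + ι N) * rising (1ℚ - (1ℚ + ι N)) k)
        ≡⟨ cong (λ i → - (- (1ℚ + ι N) * rising i k)) (solve 1 (λ n → con 1ℚ :- (con 1ℚ :+ n) := :- n) refl (ι N)) ⟩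
      - (- (1ℚ + ι N) * A)
        ≡⟨ solve 2 (λ n r → :- (:- n :* r) := n :* r) refl (1ℚ + ι N) A ⟩
      (1ℚ + ι N) * A ∎
    shiftB : B * (x + ι k) ≡ x * B′
    shiftB = trans (rising-suc x k) (cong (λ i → x * rising i k)
      (trans (sym (+-assoc 1ℚ (ι N) (1ℚ + a))) (cong (_+ (1ℚ + a)) (sym (ι-suc N)))))
    cross : s * z * numerator N k * denominator (suc N) k
          ≡ s * y * numerator (suc N) k * denominator N k
    cross = begin
      s * z * numerator N k * denominator (suc N) k
        ≡⟨ solve 9 (λ s i x A q r f B h →
             (s :* (i :* x)) :* (A :* q :* r) :* (f :* B :* h)
             := s :* ((i :* A) :* (x :* B)) :* (q :* r :* f :* h))
           refl s (1ℚ + ι N) x A (rising c k) (rising a k) (ι (k !)) B′ (rising d k) ⟩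
      s * (((1ℚ + ι N) * A) * (x * B′)) * e
        ≡⟨ cong₂ (λ u v → s * (u * v) * e) shiftA shiftB ⟨
      s * ((A′ * (1ℚ + ι N - ι k)) * (B * (x + ι k))) * e
        ≡⟨ solve 9 (λ s i x A q r f B h →
             s :* ((A :* i) :* (B :* x)) :* (q :* r :* f :* h)
             := (s :* (i :* x)) :* (A :* q :* r) :* (f :* B :* h))
           refl s (1ℚ + ι N - ι k) (x + ι k) A′ (rising c k) (rising a k) (ι (k !)) B (rising d k) ⟩
      s * y * numerator (suc N) k * denominator N k ∎
      where e = rising c k * rising a k * ι (k !) * rising d k

  ratio-vanishes : ∀ {N k} → N ℕ.< k → ratio N k ≡ 0ℚ
  ratio-vanishes {N} {k} N<k = trans
    (cong (λ r → (- 1ℚ) ^ k * (r * rising c k * rising a k * (1/ denominator N k) {{denominator-nonZero N k}}))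
          (rising-neg-vanishes N<k))
    (solve 4 (λ s q r i → s :* (con 0ℚ :* q :* r :* i) := con 0ℚ) refl
       ((- 1ℚ) ^ k) (rising c k) (rising a k) ((1/ denominator N k) {{denominator-nonZero N k}}))

  -- The right-hand side is the Wilf-Zeilberger certificate at k = m; it vanishes at m = 0
  -- because of the factor ι m and for m > N + 1 because ratio (suc N) m does.
  wz : ∀ N m →
    (1ℚ + ι N) * ((d + ι N) * partialSum (term (suc N)) m
                  - (ι N + (1ℚ + a)) * partialSum (term N) m)
    ≡ - (ratio (suc N) m * (ι m * (d - 1ℚ + ι m) * (ι N + (1ℚ + a) + ι m)))
  wz N zero = solve 4 (λ n d x r →
      (con 1ℚ :+ n) :* ((d :+ n) :* con 0ℚ :- x :* con 0ℚ)
      := :- (r :* (con 0ℚ :* (d :- con 1ℚ :+ con 0ℚ) :* (x :+ con 0ℚ))))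
    refl (ι N) d (ι N + (1ℚ + a)) (ratio (suc N) 0)
  wz N (suc m) = begin
    (1ℚ + n) * ((d + n) * (S′ + t * w) - x * (S + t * r))
      ≡⟨ solve 8 (λ n d x S S′ t w r →
           (con 1ℚ :+ n) :* ((d :+ n) :* (S′ :+ t :* w) :- x :* (S :+ t :* r))
           := (con 1ℚ :+ n) :* ((d :+ n) :* S′ :- x :* S)
              :+ t :* ((con 1ℚ :+ n) :* (d :+ n) :* w :- r :* ((con 1ℚ :+ n) :* x)))
         refl n d x S S′ t w r ⟩
    (1ℚ + n) * ((d + n) * S′ - x * S) + t * ((1ℚ + n) * (d + n) * w - r * ((1ℚ + n) * x))
      ≡⟨ cong₂ (λ u v → u + t * ((1ℚ + n) * (d + n) * w - v)) (wz N m) (ratio-suc-N N m) ⟩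
    - (w * (k * (d - 1ℚ + k) * (x + k)))
      + t * ((1ℚ + n) * (d + n) * w - w * ((1ℚ + n - k) * (x + k)))
      -- Everything is now a multiple of `w`. The remaining polynomial identity is the
      -- Wilf-Zeilberger equation; it depends on `c = 1 + a - d` and yields the factors needed to
      -- raise `m` by one.
      ≡⟨ solve 5 (λ n a d k w →
           let x = n :+ (con 1ℚ :+ a) ; t = a :+ (k :+ k) in
           :- (w :* (k :* (d :- con 1ℚ :+ k) :* (x :+ k)))
           :+ t :* ((con 1ℚ :+ n) :* (d :+ n) :* w :- w :* ((con 1ℚ :+ n :- k) :* (x :+ k)))
           := :- (:- (w :* ((:- (con 1ℚ :+ n) :+ k) :* (con 1ℚ :+ a :- d :+ k) :* (a :+ k)))))
         refl n a d k w ⟩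
    - (- (w * ((- (1ℚ + n) + k) * (c + k) * (a + k))))
      ≡⟨ cong (λ i → - (- (w * ((- i + k) * (c + k) * (a + k))))) (ι-suc N) ⟨
    - (- (w * ((- ι (suc N) + k) * (c + k) * (a + k))))
      ≡⟨ cong -_ (ratio-suc-k (suc N) m) ⟨
    - (w⁺ * ((1ℚ + k) * (ι (suc N) + (1ℚ + a) + k) * (d + k)))
      ≡⟨ cong (λ i → - (w⁺ * ((1ℚ + k) * (i + (1ℚ + a) + k) * (d + k)))) (ι-suc N) ⟩
    - (w⁺ * ((1ℚ + k) * (1ℚ + n + (1ℚ + a) + k) * (d + k)))
      ≡⟨ solve 5 (λ n a d k w →
           :- (w :* ((con 1ℚ :+ k) :* (con 1ℚ :+ n :+ (con 1ℚ :+ a) :+ k) :* (d :+ k)))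
           := :- (w :* ((con 1ℚ :+ k) :* (d :- con 1ℚ :+ (con 1ℚ :+ k))
                        :* (n :+ (con 1ℚ :+ a) :+ (con 1ℚ :+ k)))))
         refl n a d k w⁺ ⟩
    - (w⁺ * ((1ℚ + k) * (d - 1ℚ + (1ℚ + k)) * (x + (1ℚ + k))))
      ≡⟨ cong (λ i → - (w⁺ * (i * (d - 1ℚ + i) * (x + i)))) (ι-suc m) ⟨
    - (w⁺ * (ι (suc m) * (d - 1ℚ + ι (suc m)) * (x + ι (suc m)))) ∎
    where
    n = ι N
    k = ι m
    x = ι N + (1ℚ + a)
    t = a + (k + k)
    w = ratio (suc N) m
    w⁺ = ratio (suc N) (suc m)
    r = ratio N m
    S = partialSum (term N) m
    S′ = partialSum (term (suc N)) m

  -- The bound `m` is free beyond `N`, so that the induction step can compare the sums for `N` and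
  -- `N + 1` over the same range.
  sum-term : ∀ N {m} → N ℕ.< m →
    partialSum (term N) m * rising d N ≡ a * rising (1ℚ + a) N
  -- For `N = 0` only the term at index 0 survives; there `ratio` evaluates to `1ℚ` and the term to
  -- `a`.
  sum-term zero {suc m} _ = cong (_* 1ℚ) (go m)
    where
    go : ∀ m → partialSum (term 0) (suc m) ≡ a
    go zero = solve 1 (λ a → con 0ℚ :+ (a :+ (con 0ℚ :+ con 0ℚ)) :* con 1ℚ := a) refl a
    go (suc m) = begin
      partialSum (term 0) (suc m) + (a + (ι (suc m) + ι (suc m))) * ratio 0 (suc m)
        ≡⟨ cong₂ (λ u v → u + (a + (ι (suc m) + ι (suc m))) * v) (go m) (ratio-vanishes {0} {suc m} (ℕ.s≤s ℕ.z≤n)) ⟩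
      a + (a + (ι (suc m) + ι (suc m))) * 0ℚ
        ≡⟨ solve 2 (λ a t → a :+ t :* con 0ℚ := a) refl a (a + (ι (suc m) + ι (suc m))) ⟩
      a ∎
  sum-term (suc N) {m} 1+N<m = begin
    S′ * (rising d N * (d + ι N))
      ≡⟨ solve 3 (λ s r u → s :* (r :* u) := u :* s :* r) refl S′ (rising d N) (d + ι N) ⟩
    (d + ι N) * S′ * rising d N
      ≡⟨ cong (_* rising d N) step ⟩
    x * S * rising d N
      ≡⟨ *-assoc x S (rising d N) ⟩
    x * (S * rising d N)
      ≡⟨ cong (_*_ x) (sum-term N (ℕ.<-trans (ℕ.n<1+n N) 1+N<m)) ⟩
    x * (a * rising (1ℚ + a) N)
      ≡⟨ solve 3 (λ n a r → (n :+ (con 1ℚ :+ a)) :* (a :* r) := a :* (r :* (con 1ℚ :+ a :+ n))) refl (ι N) a (rising (1ℚ + a) N) ⟩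
    a * (rising (1ℚ + a) N * (1ℚ + a + ι N)) ∎
    where
    x = ι N + (1ℚ + a)
    S = partialSum (term N) m
    S′ = partialSum (term (suc N)) m
    z = ι m * (d - 1ℚ + ι m) * (x + ι m)
    -- Since `m` exceeds `N + 1`, the certificate in `wz` is zero. The factor `1ℚ + ι N`, which
    -- cleared the denominator of the shift in `N`, is positive and cancels.
    step : (d + ι N) * S′ ≡ x * S
    step = *-cancelʳ-≡ (1ℚ + ι N)
      {{>-nonZero (+-mono-<-≤ (positive⁻¹ 1ℚ) (0≤ι N))}} (begin
        (d + ι N) * S′ * (1ℚ + ι N)
          ≡⟨ solve 3 (λ i u v → u :* i := i :* (u :- v) :+ v :* i) refl (1ℚ + ι N) ((d + ι N) * S′) (x * S) ⟩
        (1ℚ + ι N) * ((d + ι N) * S′ - x * S) + x * S * (1ℚ + ι N)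
          ≡⟨ cong (_+ x * S * (1ℚ + ι N)) (wz N m) ⟩
        - (ratio (suc N) m * z) + x * S * (1ℚ + ι N)
          ≡⟨ cong (λ r → - (r * z) + x * S * (1ℚ + ι N)) (ratio-vanishes 1+N<m) ⟩
        - (0ℚ * z) + x * S * (1ℚ + ι N)
          ≡⟨ solve 2 (λ z u → :- (con 0ℚ :* z) :+ u := u) refl z (x * S * (1ℚ + ι N)) ⟩
        x * S * (1ℚ + ι N) ∎)

-- Specialisation to the given series.

partialSum-scale : ∀ {f g} s → (∀ k → f k ≡ s * g k) → ∀ m → partialSum f m ≡ s * partialSum g m
partialSum-scale s f≡sg zero = sym (*-zeroʳ s)
partialSum-scale {f} {g} s f≡sg (suc m) =
  trans (cong₂ _+_ (partialSum-scale s f≡sg m) (f≡sg m)) (sym (*-distribˡ-+ s _ (g m)))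

powerBase : ℚ
powerBase = + (2 ℕ.^ 8 ℕ.* 3 ℕ.^ 3) / 7 ℕ.^ 7

-- By evaluation `2 ^ 8 * 3 ^ 3` is `4 ^ 4 * 3 ^ 3`, so the base is the quotient of the constants
-- that the multiplication formula yields for 4, 3 and 7.
powerBase-*-7⁷ : powerBase * ι 7 ^ 7 ≡ ι 4 ^ 4 * ι 3 ^ 3
powerBase-*-7⁷ = begin
  powerBase * ι 7 ^ 7          ≡⟨ cong (_*_ powerBase) (ι-homo-^ 7 7) ⟨
  powerBase * ι (7 ℕ.^ 7)      ≡⟨ /-*-cancel (2 ℕ.^ 8 ℕ.* 3 ℕ.^ 3) (7 ℕ.^ 7) ⟩
  ι (4 ℕ.^ 4 ℕ.* 3 ℕ.^ 3)      ≡⟨ ι-homo-* (4 ℕ.^ 4) (3 ℕ.^ 3) ⟩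
  ι (4 ℕ.^ 4) * ι (3 ℕ.^ 3)    ≡⟨ cong₂ _*_ (ι-homo-^ 4 4) (ι-homo-^ 3 3) ⟩
  ι 4 ^ 4 * ι 3 ^ 3            ∎

module _ (n : ℕ) where

  private
    d : ℚ
    d = ι (4 ℕ.* n) + + 5 / 3

    0<d : 0ℚ < d
    0<d = +-mono-≤-< (0≤ι (4 ℕ.* n)) (positive⁻¹ (+ 5 / 3))

  -- Here `d` depends on `n`, so `n` is fixed first: the induction on `N` runs with `d` constant,
  -- and `N` is set to `3n` only afterwards.
  open VeryWellPoised (+ 1 / 2) d (positive⁻¹ (+ 3 / 2)) 0<d

  -- The 2 comes from `4k + 1 = 2 (1/2 + 2k)`, and `c = 3/2 - (4n + 5/3) = - 4n - 1/6`.
  summand-as-term : ∀ k → summand n k ≡ (1ℚ + 1ℚ) * term (3 ℕ.* n) k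
  summand-as-term k = begin
    s * ι (4 ℕ.* k ℕ.+ 1) * (A * rising (- ι (4 ℕ.* n) - + 1 / 6) k * B * D)
      ≡⟨ cong₂ (λ u v → s * u * (A * rising v k * B * D)) 4k+1 c≡ ⟩
    s * (+ 4 / 1 * ι k + 1ℚ) * (A * rising c k * B * D)
      ≡⟨ solve 3 (λ s k q → s :* (con (+ 4 / 1) :* k :+ con 1ℚ) :* q
                   := (con 1ℚ :+ con 1ℚ) :* ((con (+ 1 / 2) :+ (k :+ k)) :* (s :* q)))
           refl s (ι k) (A * rising c k * B * D) ⟩
    (1ℚ + 1ℚ) * term (3 ℕ.* n) k ∎
    where
    s = (- 1ℚ) ^ k
    A = rising (- ι (3 ℕ.* n)) k
    B = rising (+ 1 / 2) k
    D = (1/ summandDenominator n k) {{summandDenominator-nonZero n k}}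
    4k+1 : ι (4 ℕ.* k ℕ.+ 1) ≡ + 4 / 1 * ι k + 1ℚ
    4k+1 = trans (ι-homo-+ (4 ℕ.* k) 1) (cong (_+ 1ℚ) (ι-homo-* 4 k))
    c≡ : - ι (4 ℕ.* n) - + 1 / 6 ≡ c
    c≡ = solve 1 (λ x → :- x :- con (+ 1 / 6) := con 1ℚ :+ con (+ 1 / 2) :- (x :+ con (+ 5 / 3)))
           refl (ι (4 ℕ.* n))

  sum-summand : partialSum (summand n) (suc (3 ℕ.* n)) * rising d (3 ℕ.* n)
              ≡ rising (+ 3 / 2) (3 ℕ.* n)
  sum-summand = begin
    partialSum (summand n) m * R
      ≡⟨ cong (_* R) (partialSum-scale (1ℚ + 1ℚ) summand-as-term m) ⟩
    (1ℚ + 1ℚ) * partialSum (term (3 ℕ.* n)) m * R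
      ≡⟨ *-assoc (1ℚ + 1ℚ) (partialSum (term (3 ℕ.* n)) m) R ⟩
    (1ℚ + 1ℚ) * (partialSum (term (3 ℕ.* n)) m * R)
      ≡⟨ cong (_*_ (1ℚ + 1ℚ)) (sum-term (3 ℕ.* n) (ℕ.n<1+n (3 ℕ.* n))) ⟩
    (1ℚ + 1ℚ) * (+ 1 / 2 * rising (+ 3 / 2) (3 ℕ.* n))
      ≡⟨ solve 1 (λ r → (con 1ℚ :+ con 1ℚ) :* (con (+ 1 / 2) :* r) := r) refl (rising (+ 3 / 2) (3 ℕ.* n)) ⟩
    rising (+ 3 / 2) (3 ℕ.* n) ∎
    where
    m = suc (3 ℕ.* n)
    R = rising d (3 ℕ.* n)

  summand-vanishes : ∀ k → suc (3 ℕ.* n) ℕ.≤ k → summand n k ≡ 0ℚ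
  summand-vanishes k 3n<k = trans (summand-as-term k)
    (trans (cong (λ r → (1ℚ + 1ℚ) * ((+ 1 / 2 + (ι k + ι k)) * r)) (ratio-vanishes 3n<k))
           (solve 2 (λ s t → s :* (t :* con 0ℚ) := con 0ℚ) refl (1ℚ + 1ℚ) (+ 1 / 2 + (ι k + ι k))))

  -- Comparison with the closed form.

  -- The start `1/2` is a third of `3/2`; likewise `5/12` and `5/21` below are a quarter and a
  -- seventh of `5/3`. The progressions with step `1/m` evaluate to the listed fractions, and the
  -- leading `1ℚ` is the empty product.
  gauss₃ : rising (+ 3 / 2) (3 ℕ.* n) ≡ (ι 3 ^ 3) ^ n *
    (1ℚ * rising (+ 1 / 2) n * rising (+ 5 / 6) n * rising (+ 7 / 6) n)
  gauss₃ = trans (cong (rising (+ 3 / 2)) (ℕ.*-comm 3 n))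
                 (rising-multiplication 3 {+ 1 / 3} refl (+ 1 / 2) n)

  gauss₄ : rising (+ 5 / 3) (4 ℕ.* n) ≡ (ι 4 ^ 4) ^ n *
    (1ℚ * rising (+ 5 / 12) n * rising (+ 2 / 3) n * rising (+ 11 / 12) n * rising (+ 7 / 6) n)
  gauss₄ = trans (cong (rising (+ 5 / 3)) (ℕ.*-comm 4 n))
                 (rising-multiplication 4 {+ 1 / 4} refl (+ 5 / 12) n)

  gauss₇ : rising (+ 5 / 3) (7 ℕ.* n) ≡ (ι 7 ^ 7) ^ n *
    (1ℚ * rising (+ 5 / 21) n * rising (+ 8 / 21) n * rising (+ 11 / 21) n * rising (+ 2 / 3) n
        * rising (+ 17 / 21) n * rising (+ 20 / 21) n * rising (+ 23 / 21) n)
  gauss₇ = trans (cong (rising (+ 5 / 3)) (ℕ.*-comm 7 n))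
                 (rising-multiplication 7 {+ 1 / 7} refl (+ 5 / 21) n)

  -- Multiplication by `t` completes `productDenominator` to the seven rising factorials in
  -- `gauss₇`, and `Q₇` supplies the power of `7 ^ 7`. Both multipliers are positive and can be
  -- cancelled.
  sum≡closedForm : partialSum (summand n) (suc (3 ℕ.* n)) ≡ closedForm n
  sum≡closedForm = *-cancelʳ-≡ PD (*-cancelʳ-≡ (t * Q₇) {{>-nonZero 0<tQ₇}} (begin
    S * PD * (t * Q₇)
      ≡⟨ solve 9 (λ S Q a b e f t g h →
           S :* (e :* h :* a :* f :* b :* g) :* (t :* Q)
           := S :* (Q :* (con 1ℚ :* a :* b :* e :* t :* f :* g :* h)))
         refl S Q₇ (rising (+ 5 / 21) n) (rising (+ 8 / 21) n) (rising (+ 11 / 21) n)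
         (rising (+ 17 / 21) n) t (rising (+ 20 / 21) n) (rising (+ 23 / 21) n) ⟩
    S * (Q₇ * P₇)
      ≡⟨ cong (_*_ S) gauss₇ ⟨
    S * rising (+ 5 / 3) (7 ℕ.* n)
      ≡⟨ cong (λ i → S * rising (+ 5 / 3) i) (ℕ.*-distribʳ-+ n 4 3) ⟩
    S * rising (+ 5 / 3) (4 ℕ.* n ℕ.+ 3 ℕ.* n)
      -- Splitting after `4n` factors turns the base `5/3` into `4n + 5/3 = d`, which gives exactly
      -- the factor that `sum-summand` absorbs.
      ≡⟨ cong (_*_ S) (rising-+ (+ 5 / 3) (4 ℕ.* n) (3 ℕ.* n)) ⟩
    S * (rising (+ 5 / 3) (4 ℕ.* n) * rising d (3 ℕ.* n))
      ≡⟨ solve 3 (λ s u v → s :* (u :* v) := u :* (s :* v)) refl S (rising (+ 5 / 3) (4 ℕ.* n)) (rising d (3 ℕ.* n)) ⟩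
    rising (+ 5 / 3) (4 ℕ.* n) * (S * rising d (3 ℕ.* n))
      ≡⟨ cong (_*_ (rising (+ 5 / 3) (4 ℕ.* n))) sum-summand ⟩
    rising (+ 5 / 3) (4 ℕ.* n) * rising (+ 3 / 2) (3 ℕ.* n)
      ≡⟨ cong₂ _*_ gauss₄ gauss₃ ⟩
    (Q₄ * P₄) * (Q₃ * P₃)
      ≡⟨ solve 4 (λ q₄ p₄ q₃ p₃ → (q₄ :* p₄) :* (q₃ :* p₃) := (q₄ :* q₃) :* (p₄ :* p₃)) refl Q₄ P₄ Q₃ P₃ ⟩
    (Q₄ * Q₃) * (P₄ * P₃)
      ≡⟨ cong (_* (P₄ * P₃)) powers ⟨
    (Q * Q₇) * (P₄ * P₃)
      -- `g` stands for the rising factorial of `7/6`, which occurs in both `P₃` and `P₄`; hence the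
      -- square.
      ≡⟨ solve 8 (λ Q Q₇ a b e f g t →
           (Q :* Q₇) :* ((con 1ℚ :* f :* t :* a :* g) :* (con 1ℚ :* e :* b :* g))
           := Q :* (a :* b :* e :* f :* (g :* (g :* con 1ℚ))) :* (t :* Q₇))
         refl Q Q₇ (rising (+ 11 / 12) n) (rising (+ 5 / 6) n) (rising (+ 1 / 2) n)
         (rising (+ 5 / 12) n) (rising (+ 7 / 6) n) t ⟩
    Q * Num * (t * Q₇)
      ≡⟨ cong (λ u → Q * u * (t * Q₇)) (÷-*-cancel Num PD) ⟨
    Q * ((Num ÷ PD) * PD) * (t * Q₇)
      ≡⟨ cong (_* (t * Q₇)) (*-assoc Q (Num ÷ PD) PD) ⟨
    closedForm n * PD * (t * Q₇) ∎))
    where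
    PD = productDenominator n
    instance
      _ = productDenominator-nonZero n
    S = partialSum (summand n) (suc (3 ℕ.* n))
    t = rising (+ 2 / 3) n
    Q  = powerBase ^ n
    Q₃ = (ι 3 ^ 3) ^ n
    Q₄ = (ι 4 ^ 4) ^ n
    Q₇ = (ι 7 ^ 7) ^ n
    Num = rising (+ 11 / 12) n * rising (+ 5 / 6) n * rising (+ 1 / 2) n
        * rising (+ 5 / 12) n * rising (+ 7 / 6) n ^ 2
    P₃ = 1ℚ * rising (+ 1 / 2) n * rising (+ 5 / 6) n * rising (+ 7 / 6) n
    P₄ = 1ℚ * rising (+ 5 / 12) n * t * rising (+ 11 / 12) n * rising (+ 7 / 6) n
    P₇ = 1ℚ * rising (+ 5 / 21) n * rising (+ 8 / 21) n * rising (+ 11 / 21) n * t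
        * rising (+ 17 / 21) n * rising (+ 20 / 21) n * rising (+ 23 / 21) n
    0<tQ₇ : 0ℚ < t * Q₇
    0<tQ₇ = 0<* (0<rising (positive⁻¹ (+ 2 / 3)) n) (0<^ (0<^ (positive⁻¹ (ι 7)) 7) n)
    powers : Q * Q₇ ≡ Q₄ * Q₃
    powers = begin
      Q * Q₇                          ≡⟨ ^-distrib-* powerBase (ι 7 ^ 7) n ⟨
      (powerBase * ι 7 ^ 7) ^ n       ≡⟨ cong (_^ n) powerBase-*-7⁷ ⟩
      (ι 4 ^ 4 * ι 3 ^ 3) ^ n         ≡⟨ ^-distrib-* (ι 4 ^ 4) (ι 3 ^ 3) n ⟩
      Q₄ * Q₃                         ∎

theorem11 : (n : ℕ) →
    (∀ k → 3 ℕ.* n ℕ.< k → rising (- ι (3 ℕ.* n)) k ≡ 0ℚ)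
    × HasFiniteSum (summand n) (closedForm n)
theorem11 n = (λ k → rising-neg-vanishes)
            -- The bound is `3n + 1` because the range is half-open and must include the term at
            -- `k = 3n`.
            , suc (3 ℕ.* n) , summand-vanishes n , sum≡closedForm n
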